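{- Let $c\geq 0$ and $b\geq 2$ be integers and let $u\in U_{[c,b]}$. Set $d=\gcd(2,b-1)$. Then there exist arbitrarily long finite sequences of $d$-consecutive $u$-attracted numbers for $S_{[c,b]}$.
   Context: For integers $c\ge 0$, $b\ge 2$, the function $S_{[c,b]}:\mathbb{Z}^+\to\mathbb{Z}^+$ is defined by $S_{[c,b]}(a)=c+\sum_{i=0}^n a_i^2$, where $a=\sum_{i=0}^n a_i b^i$ with integers $0\le a_i\le b-1$ is the base-$b$ expansion of the positive integer $a$. $S_{[c,b]}^k$ denotes the $k$-fold iterate ($S_{[c,b]}^0$ is the identity). $U_{[c,b]}=\{a\in\mathbb{Z}^+ \mid S_{[c,b]}^m(a)=a \text{ for some } m\in\mathbb{Z}^+\}$ is the set of all elements of fixed points and cycles of $S_{[c,b]}$. For $u\in U_{[c,b]}$, a positive integer $a$ is a $u$-attracted number (for $S_{[c,b]}$) if $S_{[c,b]}^k(a)=u$ for some $k\in\mathbb{Z}_{\ge 0}$. A sequence of positive integers is $d$-consecutive if it is an arithmetic sequence with constant difference $d$. "Arbitrarily long" means: for every $N\in\mathbb{Z}^+$ there is such a sequence with $N$ terms. -}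

module Defs where

open import Data.Digit using (Expansion; fromDigits; toDigits)
open import Data.Fin.Base using (toℕ; zero; suc)
open import Data.List.Base using ([]; _∷_; map)
open import Data.Nat.Base
open import Data.Nat.GeneralisedArithmetic using (iterate)
open import Data.Nat.ListAction using (sum)
open import Data.Nat.Properties
open import Data.Product.Base using (∃-syntax; _×_; proj₁; proj₂)
open import Data.Vec.Base using (Vec)
open import Data.Vec.Relation.Unary.Linked using (Linked)
open import Relation.Binary.PropositionalEquality
open import Relation.Nullary.Decidable using (fromWitness)

digits : ∀ b → .{{NonTrivial b}} → ℕ → Expansion b
digits b a = proj₁ (toDigits b {fromWitness (nonTrivial⇒n>1 b)} a)

sumOfSquares : ∀ {b} → Expansion b → ℕ
sumOfSquares ds = sum (map (λ d → toℕ d ^ 2) ds)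

-- Positive integers are represented by naturals a with 0 < a.  The junk value
-- S c b 0 = c is never used: every notion below is restricted to positive
-- integers, and these are preserved by S (S-positive).
S : (c b : ℕ) → .{{NonTrivial b}} → ℕ → ℕ
S c b a = c + sumOfSquares (digits b a)

sumOfSquares-positive : ∀ {b} (ds : Expansion b) →
                        0 < fromDigits ds → 0 < sumOfSquares ds
sumOfSquares-positive (zero  ∷ ds) p =
  sumOfSquares-positive ds (n≢0⇒n>0 λ q → n>0⇒n≢0 p (cong (_* _) q))
sumOfSquares-positive (suc d ∷ ds) _ = z<s

S-positive : ∀ c b .{{_ : NonTrivial b}} {a} → 0 < a → 0 < S c b a
S-positive c b {a} a>0 =
  ≤-trans (sumOfSquares-positive (digits b a) (subst (0 <_) (sym eq) a>0))
          (m≤n+m _ c)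
  where
  eq : fromDigits (digits b a) ≡ a
  eq = proj₂ (toDigits b {fromWitness (nonTrivial⇒n>1 b)} a)

-- iterate f x k is the k-fold iterate f^k applied to x.
U : (c b : ℕ) → .{{NonTrivial b}} → ℕ → Set
U c b a = 0 < a × ∃[ m ] (0 < m × iterate (S c b) a m ≡ a)

Attracted : (c b : ℕ) → .{{NonTrivial b}} → (u a : ℕ) → Set
Attracted c b u a = 0 < a × ∃[ k ] iterate (S c b) a k ≡ u

Consecutive : ℕ → ∀ {N} → Vec ℕ N → Set
Consecutive d = Linked (λ x y → y ≡ x + d)

{-# OPTIONS --safe #-}

-- Adding M·bʳ to numbers below bʳ adds the digit squares of M to their images
-- under S, so a later translation can be traded for an earlier one.  It is
-- therefore enough to send a finite set to u by a word in S and translations.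
-- Such a word merges two elements x, y at a time: if x ≡ y mod b−1, a translate
-- of the pair has the form v·b + bʳ, v + bʳ, whose nonzero digits agree; otherwise
-- one first makes the images congruent mod b−1.  For odd b this needs x ≡ y mod 2,
-- a relation that S and translations preserve.
module Submission where

open import Defs
open import Data.Digit using (Expansion; fromDigits; toDigits)
open import Data.Fin.Base using (toℕ; fromℕ<)
open import Data.Fin.Properties using (toℕ<n; toℕ-fromℕ<)
open import Data.List.Base using (List; []; _∷_; _++_; length; replicate)
open import Data.Nat.Base
open import Data.Nat.Divisibility
open import Data.Nat.DivMod
open import Data.Nat.GCD using (gcd; gcd-greatest)
open import Data.Nat.GeneralisedArithmetic using (iterate)
open import Data.Nat.Properties
open import Data.Nat.Tactic.RingSolver using (solve-∀)
open import Data.Product.Base using (Σ-syntax; ∃-syntax; _×_; _,_; proj₁; proj₂)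
open import Data.Sum.Base using (inj₁; inj₂)
open import Data.Vec.Base using (Vec; tabulate)
open import Data.Vec.Relation.Unary.All using (All)
open import Data.Vec.Relation.Unary.All.Properties using (tabulate⁺)
open import Data.Vec.Relation.Unary.Linked using ([]; [-]; _∷_)
open import Function.Base using (_∘_)
open import Relation.Binary.PropositionalEquality
open import Relation.Nullary using (¬_; yes; no; contradiction)
open import Relation.Nullary.Decidable using (fromWitness)

-- Parity, bounds and powers

2∣n²+n : ∀ n → 2 ∣ n ^ 2 + n
2∣n²+n zero    = 2 ∣0
2∣n²+n (suc n) =
  subst (2 ∣_) (step n) (∣m∣n⇒∣m+n (2∣n²+n n) (n∣m*n (suc n)))
  where
  step : ∀ n → n * (n * 1) + n + suc n * 2 ≡ suc n * (suc n * 1) + suc n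
  step = solve-∀

2∤m⇒2∣1+m : ∀ m → ¬ 2 ∣ m → 2 ∣ suc m
2∤m⇒2∣1+m zero          2∤m = contradiction (2 ∣0) 2∤m
2∤m⇒2∣1+m (suc zero)    _   = ∣-refl
2∤m⇒2∣1+m (suc (suc m)) 2∤m =
  ∣m∣n⇒∣m+n ∣-refl (2∤m⇒2∣1+m m (2∤m ∘ ∣m∣n⇒∣m+n ∣-refl))

2∤m∧2∤n⇒2∣m+n : ∀ m n → ¬ 2 ∣ m → ¬ 2 ∣ n → 2 ∣ m + n
2∤m∧2∤n⇒2∣m+n m n 2∤m 2∤n =
  ∣m+n∣m⇒∣n
    (subst (2 ∣_) (cong suc (+-suc m n))
      (∣m∣n⇒∣m+n (2∤m⇒2∣1+m m 2∤m) (2∤m⇒2∣1+m n 2∤n)))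
    ∣-refl

-- If `e` is odd, adding it once corrects an odd `m`; if `e` is even, no multiple changes the
-- parity, which is the case that the hypothesis covers.
even-shift : ∀ m e → (2 ∣ e → 2 ∣ m) → ∃[ i ] 2 ∣ m + i * e
even-shift m e h with 2 ∣? m | 2 ∣? e
... | yes 2∣m | _       = 0 , subst (2 ∣_) (sym (+-identityʳ m)) 2∣m
... | no 2∤m  | yes 2∣e = contradiction (h 2∣e) 2∤m
... | no 2∤m  | no 2∤e  =
  1 , subst (λ x → 2 ∣ m + x) (sym (+-identityʳ e)) (2∤m∧2∤n⇒2∣m+n m e 2∤m 2∤e)

bounded : ∀ (f : ℕ → ℕ) N → ∃[ B ] (∀ {i} → i ≤ N → f i ≤ B)
bounded f zero    = f 0 , λ { z≤n → ≤-refl }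
bounded f (suc N) with bounded f N
... | B , f≤B = B ⊔ f (suc N) , bound
  where
  bound : ∀ {i} → i ≤ suc N → f i ≤ B ⊔ f (suc N)
  bound i≤1+N with m≤n⇒m<n∨m≡n i≤1+N
  ... | inj₁ i<1+N = ≤-trans (f≤B (s≤s⁻¹ i<1+N)) (m≤m⊔n B _)
  ... | inj₂ refl  = m≤n⊔m B _

n<b^n : ∀ b .{{_ : NonTrivial b}} n → n < b ^ n
n<b^n b zero    = z<s
n<b^n b (suc n) = begin-strict
  suc n      ≤⟨ n<b^n b n ⟩
  b ^ n      <⟨ ^-monoʳ-< b (nonTrivial⇒n>1 b) {n} ≤-refl ⟩
  b ^ suc n  ∎
  where open ≤-Reasoning

-- Base-`b` expansions

module _ {b : ℕ} .{{_ : NonZero b}} where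

  quotRem-unique : ∀ {j k} → j < b → k < b → ∀ x y →
                   j + x * b ≡ k + y * b → j ≡ k × x ≡ y
  quotRem-unique {j} {k} j<b k<b x y eq = j≡k , x≡y
    where
    rem : ∀ {j} → j < b → ∀ x → (j + x * b) % b ≡ j
    rem {j} j<b x = trans ([m+kn]%n≡m%n j x b) (m<n⇒m%n≡m j<b)
    j≡k : j ≡ k
    j≡k = trans (sym (rem j<b x)) (trans (cong (_% b) eq) (rem k<b y))
    x≡y : x ≡ y
    x≡y = *-cancelʳ-≡ x y b
      (+-cancelˡ-≡ j _ _ (trans eq (cong (_+ y * b) (sym j≡k))))

  -- Expansions of one number differ only in leading zeros, which contribute nothing. Hence any
  -- convenient expansion may replace the output of `toDigits`.
  sumOfSquares-cong : (ds es : Expansion b) → fromDigits ds ≡ fromDigits es →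
                      sumOfSquares ds ≡ sumOfSquares es
  sumOfSquares-cong []       []       _  = refl
  sumOfSquares-cong []       (e ∷ es) eq =
    let 0≡e , 0≡es = quotRem-unique (>-nonZero⁻¹ b) (toℕ<n e) 0 (fromDigits es) eq
    in cong₂ (λ x y → x ^ 2 + y) 0≡e (sumOfSquares-cong [] es 0≡es)
  sumOfSquares-cong (d ∷ ds) []       eq =
    let d≡0 , ds≡0 = quotRem-unique (toℕ<n d) (>-nonZero⁻¹ b) (fromDigits ds) 0 eq
    in cong₂ (λ x y → x ^ 2 + y) d≡0 (sumOfSquares-cong ds [] ds≡0)
  sumOfSquares-cong (d ∷ ds) (e ∷ es) eq =
    let d≡e , ds≡es = quotRem-unique (toℕ<n d) (toℕ<n e) _ _ eq
    in cong₂ (λ x y → x ^ 2 + y) d≡e (sumOfSquares-cong ds es ds≡es)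

-- Modulo 2, each digit equals its square and the odd base `suc e` equals 1.
sumOfSquares-parity : ∀ {e} → 2 ∣ e → (ds : Expansion (suc e)) →
                      2 ∣ sumOfSquares ds + fromDigits ds
sumOfSquares-parity     2∣e []       = 2 ∣0
sumOfSquares-parity {e} 2∣e (d ∷ ds) =
  subst (2 ∣_) (regroup (toℕ d) (toℕ d ^ 2) (sumOfSquares ds) (fromDigits ds) e)
    (∣m∣n⇒∣m+n (∣m∣n⇒∣m+n (2∣n²+n (toℕ d)) (sumOfSquares-parity 2∣e ds))
               (∣n⇒∣m*n (fromDigits ds) 2∣e))
  where
  regroup : ∀ d d² s n e →
            d² + d + (s + n) + n * e ≡ d² + s + (d + n * suc e)
  regroup = solve-∀

-- The sum of digit squares

module DigitSquares (b : ℕ) .{{nt : NonTrivial b}} where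

  instance
    b≢0 : NonZero b
    b≢0 = nonTrivial⇒nonZero b

    b-1≢0 : NonZero (pred b)
    b-1≢0 = >-nonZero (s≤s⁻¹ (subst (1 <_) (sym (suc-pred b)) (nonTrivial⇒n>1 b)))

  s : ℕ → ℕ
  s a = sumOfSquares (digits b a)

  fromDigits-digits : ∀ a → fromDigits (digits b a) ≡ a
  fromDigits-digits a = proj₂ (toDigits b {fromWitness (nonTrivial⇒n>1 b)} a)

  s-fromDigits : (ds : Expansion b) → s (fromDigits ds) ≡ sumOfSquares ds
  s-fromDigits ds =
    sumOfSquares-cong (digits b (fromDigits ds)) ds (fromDigits-digits (fromDigits ds))

  s-0 : s 0 ≡ 0
  s-0 = s-fromDigits []

  s-+-* : ∀ {j} → j < b → ∀ a → s (j + a * b) ≡ j ^ 2 + s a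
  s-+-* {j} j<b a = begin
    s (j + a * b)
      ≡⟨ cong s (cong₂ (λ x y → x + y * b) (toℕ-fromℕ< j<b) (fromDigits-digits a)) ⟨
    s (fromDigits (fromℕ< j<b ∷ digits b a))
      ≡⟨ s-fromDigits (fromℕ< j<b ∷ digits b a) ⟩
    toℕ (fromℕ< j<b) ^ 2 + s a
      ≡⟨ cong (λ x → x ^ 2 + s a) (toℕ-fromℕ< j<b) ⟩
    j ^ 2 + s a  ∎
    where open ≡-Reasoning

  s-* : ∀ a → s (a * b) ≡ s a
  s-* = s-+-* (>-nonZero⁻¹ b)

  s-digit : ∀ {j} → j < b → s j ≡ j ^ 2
  s-digit {j} j<b = begin
    s j          ≡⟨ cong s (+-identityʳ j) ⟨
    s (j + 0)    ≡⟨ s-+-* j<b 0 ⟩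
    j ^ 2 + s 0  ≡⟨ cong (j ^ 2 +_) s-0 ⟩
    j ^ 2 + 0    ≡⟨ +-identityʳ _ ⟩
    j ^ 2        ∎
    where open ≡-Reasoning

  s-1 : s 1 ≡ 1
  s-1 = s-digit (nonTrivial⇒n>1 b)

  -- No carries occur: `x` fills the lowest `r` digit positions and `y` those above. The induction
  -- peels off the lowest digit of `x`.
  s-+-*^ : ∀ r {x} → x < b ^ r → ∀ y → s (x + y * b ^ r) ≡ s x + s y
  s-+-*^ zero    {zero} _ y = trans (cong s (*-identityʳ y)) (cong (_+ s y) (sym s-0))
  s-+-*^ zero    {suc _} (s≤s ()) y
  s-+-*^ (suc r) {x} x<b^1+r y = begin
    s (x + y * b ^ suc r)
      ≡⟨ cong s (trans (cong (_+ y * b ^ suc r) (m≡m%n+[m/n]*n x b))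
                       (regroup (x % b) (x / b) y b (b ^ r))) ⟩
    s (x % b + (x / b + y * b ^ r) * b)
      ≡⟨ s-+-* (m%n<n x b) _ ⟩
    (x % b) ^ 2 + s (x / b + y * b ^ r)
      ≡⟨ cong ((x % b) ^ 2 +_) (s-+-*^ r x/b<b^r y) ⟩
    (x % b) ^ 2 + (s (x / b) + s y)
      ≡⟨ +-assoc ((x % b) ^ 2) _ _ ⟨
    (x % b) ^ 2 + s (x / b) + s y
      ≡⟨ cong (_+ s y) (s-+-* (m%n<n x b) (x / b)) ⟨
    s (x % b + x / b * b) + s y
      ≡⟨ cong (λ z → s z + s y) (m≡m%n+[m/n]*n x b) ⟨
    s x + s y  ∎
    where
    open ≡-Reasoning
    x/b<b^r : x / b < b ^ r
    x/b<b^r = m<n*o⇒m/o<n (subst (x <_) (*-comm b (b ^ r)) x<b^1+r)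
    regroup : ∀ m q y b p → m + q * b + y * (b * p) ≡ m + (q + y * p) * b
    regroup = solve-∀

  s-*^ : ∀ r y → s (y * b ^ r) ≡ s y
  s-*^ r y = trans (s-+-*^ r (m^n>0 b r) y) (cong (_+ s y) s-0)

  repunit : ℕ → ℕ
  repunit zero    = 0
  repunit (suc n) = 1 + repunit n * b

  s-repunit : ∀ n → s (repunit n) ≡ n
  s-repunit zero    = s-0
  s-repunit (suc n) = trans (s-+-* (nonTrivial⇒n>1 b) (repunit n)) (cong suc (s-repunit n))

  s-parity : 2 ∣ pred b → ∀ a → 2 ∣ s a + a
  s-parity 2∣b-1 a =
    subst (λ x → 2 ∣ s a + x) (fromDigits-digits a) (lift-parity (suc-pred b) (digits b a))
    where
    lift-parity : ∀ {b′} → suc (pred b) ≡ b′ → (ds : Expansion b′) →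
             2 ∣ sumOfSquares ds + fromDigits ds
    lift-parity refl = sumOfSquares-parity 2∣b-1

  -- The difference `v * pred b` is also that of `v * b` and `v`, which have the same nonzero
  -- digits.
  congruent⇒s-equal : ∀ a v → ∃[ n ] s (a + v * pred b + n) ≡ s (a + n)
  congruent⇒s-equal a v = n ,
    trans (trans (cong s upper) s-upper) (sym (trans (cong s lower) s-lower))
    where
    -- Large enough that `v * b` lies below `b ^ r`, and that `v + b ^ r` is at least `a`, so the
    -- subtraction defining `n` is not truncated.
    r = a + v * b
    v*b<b^r : v * b < b ^ r
    v*b<b^r = ≤-<-trans (m≤n+m (v * b) a) (n<b^n b r)
    a≤v+b^r : a ≤ v + 1 * b ^ r
    a≤v+b^r = begin
      a              ≤⟨ m≤m+n a (v * b) ⟩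
      r              ≤⟨ <⇒≤ (n<b^n b r) ⟩
      b ^ r          ≡⟨ *-identityˡ (b ^ r) ⟨
      1 * b ^ r      ≤⟨ m≤n+m _ v ⟩
      v + 1 * b ^ r  ∎
      where open ≤-Reasoning
    n = v + 1 * b ^ r ∸ a
    lower : a + n ≡ v + 1 * b ^ r
    lower = m+[n∸m]≡n a≤v+b^r
    upper : a + v * pred b + n ≡ v * b + 1 * b ^ r
    upper = begin
      a + v * pred b + n              ≡⟨ regroup₁ a n v (pred b) ⟩
      a + n + v * pred b              ≡⟨ cong (_+ v * pred b) lower ⟩
      v + 1 * b ^ r + v * pred b      ≡⟨ regroup₂ v (pred b) (1 * b ^ r) ⟩
      v * suc (pred b) + 1 * b ^ r    ≡⟨ cong (λ x → v * x + 1 * b ^ r) (suc-pred b) ⟩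
      v * b + 1 * b ^ r               ∎
      where
      open ≡-Reasoning
      regroup₁ : ∀ a n v e → a + v * e + n ≡ a + n + v * e
      regroup₁ = solve-∀
      regroup₂ : ∀ v e p → v + p + v * e ≡ v * suc e + p
      regroup₂ = solve-∀
    s-upper : s (v * b + 1 * b ^ r) ≡ s v + s 1
    s-upper = trans (s-+-*^ r v*b<b^r 1) (cong (_+ s 1) (s-* v))
    s-lower : s (v + 1 * b ^ r) ≡ s v + s 1
    s-lower = s-+-*^ r (≤-<-trans (m≤m*n v b) v*b<b^r) 1

-- Words in `f` and translations

module Attraction (c b : ℕ) .{{nt : NonTrivial b}} where

  open DigitSquares b

  f : ℕ → ℕ
  f = S c b

  -- run (n₁ ∷ … ∷ nₖ ∷ []) adds n₁, applies f, adds n₂, applies f, and so on.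
  run : List ℕ → ℕ → ℕ
  run []       a = a
  run (n ∷ ns) a = run ns (f (a + n))

  run-++ : ∀ ms ns a → run (ms ++ ns) a ≡ run ns (run ms a)
  run-++ []       ns a = refl
  run-++ (m ∷ ms) ns a = run-++ ms ns (f (a + m))

  run-zeros : ∀ k a → run (replicate k 0) a ≡ iterate f a k
  run-zeros zero    a = refl
  run-zeros (suc k) a =
    trans (run-zeros k (f (a + 0))) (cong (λ x → iterate f (f x) k) (+-identityʳ a))

  -- An addition after f becomes one before f: prefix a repunit whose digit
  -- squares sum to the required amount, far beyond the digits of all t i.
  run⇒iterate : ∀ ns (t : ℕ → ℕ) N →
                ∃[ n ] (∀ {i} → i ≤ N → iterate f (t i + n) (length ns) ≡ run ns (t i))
  run⇒iterate []       t N = 0 , λ _ → +-identityʳ _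
  run⇒iterate (n ∷ ns) t N = n + M , λ {i} i≤N →
    trans (cong (λ x → iterate f x (length ns)) (step i≤N)) (ih i≤N)
    where
    -- The recursion comes first: it returns the translation `m` still needed after `f`, which fixes
    -- the length of the repunit.
    rest = run⇒iterate ns (λ i → f (t i + n)) N
    m = proj₁ rest
    ih = proj₂ rest
    -- The bound itself serves as exponent, by `n<b^n`.
    r = proj₁ (bounded (λ i → t i + n) N)
    M = repunit m * b ^ r
    step : ∀ {i} → i ≤ N → f (t i + (n + M)) ≡ f (t i + n) + m
    step {i} i≤N = begin
      c + s (t i + (n + M))            ≡⟨ cong (λ x → c + s x) (+-assoc (t i) n M) ⟨
      c + s (t i + n + M)              ≡⟨ cong (c +_) (s-+-*^ r t+n<b^r (repunit m)) ⟩
      c + (s (t i + n) + s (repunit m))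
        ≡⟨ cong (λ x → c + (s (t i + n) + x)) (s-repunit m) ⟩
      c + (s (t i + n) + m)            ≡⟨ +-assoc c _ m ⟨
      c + s (t i + n) + m              ∎
      where
      open ≡-Reasoning
      t+n<b^r : t i + n < b ^ r
      t+n<b^r = ≤-<-trans (proj₂ (bounded (λ i → t i + n) N) i≤N) (n<b^n b r)

  -- The parity relation

  infix 4 _∼_
  -- Equal parity for odd `b`, and no condition for even `b`. The sum stands in for the difference,
  -- which would be truncated.
  _∼_ : ℕ → ℕ → Set
  x ∼ y = 2 ∣ pred b → 2 ∣ x + y

  ∼-sym : ∀ {x y} → x ∼ y → y ∼ x
  ∼-sym {x} x∼y 2∣b-1 = subst (2 ∣_) (+-comm x _) (x∼y 2∣b-1)

  -- For odd `b`, `s` preserves parity, and both sides receive the same `n` and `c`, which cancel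
  -- modulo 2.
  run-∼ : ∀ ns {x y} → x ∼ y → run ns x ∼ run ns y
  run-∼ []       x∼y = x∼y
  run-∼ (n ∷ ns) {x} {y} x∼y = run-∼ ns λ 2∣b-1 →
    ∣m+n∣m⇒∣n
      (subst (2 ∣_) (regroup x y (s (x + n)) (s (y + n)) c n)
        (∣m∣n⇒∣m+n
          (∣m∣n⇒∣m+n (s-parity 2∣b-1 (x + n)) (s-parity 2∣b-1 (y + n)))
          (∣m∣n⇒∣m+n (x∼y 2∣b-1) (m∣m*n c))))
      (m∣m*n (x + y + n))
    where
    regroup : ∀ x y s₁ s₂ c n →
              s₁ + (x + n) + (s₂ + (y + n)) + (x + y + 2 * c) ≡
              2 * (x + y + n) + (c + s₁ + (c + s₂))
    regroup = solve-∀

  -- Merging two elements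

  Mergeable : ℕ → ℕ → Set
  Mergeable x y = ∃[ ns ] run ns x ≡ run ns y

  Mergeable-sym : ∀ {x y} → Mergeable x y → Mergeable y x
  Mergeable-sym (ns , eq) = ns , sym eq

  -- Cancelling `p * pred b` leaves the case of `congruent⇒s-equal`, so one translation and one
  -- application of `f` suffice.
  congruent⇒mergeable-≤ : ∀ {x y p q} → p ≤ q →
                           x + p * pred b ≡ y + q * pred b → Mergeable x y
  congruent⇒mergeable-≤ {x} {y} {p} {q} p≤q eq =
    n ∷ [] , cong (c +_) (trans (cong (λ z → s (z + n)) x≡) s≡s)
    where
    v = q ∸ p
    n = proj₁ (congruent⇒s-equal y v)
    s≡s = proj₂ (congruent⇒s-equal y v)
    regroup : ∀ y p v e → y + (p + v) * e ≡ y + v * e + p * e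
    regroup = solve-∀
    x≡ : x ≡ y + v * pred b
    x≡ = +-cancelʳ-≡ (p * pred b) x _ (begin
      x + p * pred b                 ≡⟨ eq ⟩
      y + q * pred b                 ≡⟨ cong (λ z → y + z * pred b) (m+[n∸m]≡n p≤q) ⟨
      y + (p + v) * pred b           ≡⟨ regroup y p v (pred b) ⟩
      y + v * pred b + p * pred b    ∎)
      where open ≡-Reasoning

  congruent⇒mergeable : ∀ {x y} p q → x + p * pred b ≡ y + q * pred b → Mergeable x y
  congruent⇒mergeable p q eq with ≤-total p q
  ... | inj₁ p≤q = congruent⇒mergeable-≤ p≤q eq
  ... | inj₂ q≤p = Mergeable-sym (congruent⇒mergeable-≤ q≤p (sym eq))

  -- With n chosen so that y + w + n = (j+1)·bʳ and y + n = z + j·bʳ, where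
  -- z = bʳ − w does not depend on j, the images under f differ by 2j+1 − s z.
  -- The digit j is chosen so that b−1 divides this difference.
  mergeable-+ : ∀ y w → 0 < w → y + w ∼ y → Mergeable (y + w) y
  -- Any `i` making `s z + i * pred b` odd allows `2j + 1` to be congruent to `s z` modulo `pred b`.
  mergeable-+ y w 0<w x∼y with even-shift (suc (s (b ^ (y + w) ∸ w))) (pred b) 2∣b-1⇒2∣1+sz
    where
    r = y + w
    z = b ^ r ∸ w
    z+w≡b^r : z + w ≡ b ^ r
    z+w≡b^r = m∸n+n≡m (≤-trans (m≤n+m w y) (<⇒≤ (n<b^n b r)))
    -- For odd `b`, `s z` has the parity of `z`, and `z + w` is the odd number `b ^ r` with `w`
    -- even.
    2∣b-1⇒2∣1+sz : 2 ∣ pred b → 2 ∣ suc (s z)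
    2∣b-1⇒2∣1+sz 2∣b-1 = ∣m+n∣m⇒∣n
      (subst (2 ∣_) total (∣m∣n⇒∣m+n (∣m∣n⇒∣m+n (s-parity 2∣b-1 z) 2∣1+b^r) 2∣w))
      (m∣m*n (b ^ r))
      where
      2∣1+b^r : 2 ∣ 1 + b ^ r
      -- The digit squares of `b ^ r` sum to 1, so `s-parity` makes it odd.
      2∣1+b^r = subst (2 ∣_)
        (cong₂ _+_ (trans (s-*^ r 1) s-1) (*-identityˡ (b ^ r)))
        (s-parity 2∣b-1 (1 * b ^ r))
      regroup₁ : ∀ y w → y + w + y ≡ 2 * y + w
      regroup₁ = solve-∀
      2∣w : 2 ∣ w
      2∣w = ∣m+n∣m⇒∣n (subst (2 ∣_) (regroup₁ y w) (x∼y 2∣b-1)) (m∣m*n y)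
      regroup₂ : ∀ q z w p → q + z + (1 + p) + w ≡ (z + w) + p + suc q
      regroup₂ = solve-∀
      regroup₃ : ∀ q p → p + p + suc q ≡ 2 * p + suc q
      regroup₃ = solve-∀
      total : s z + z + (1 + b ^ r) + w ≡ 2 * b ^ r + suc (s z)
      total = trans (regroup₂ (s z) z w (b ^ r))
        (trans (cong (λ v → v + b ^ r + suc (s z)) z+w≡b^r) (regroup₃ (s z) (b ^ r)))
  ... | i , divides (suc k) eq = n ∷ proj₁ merged , proj₂ merged
    where
    e = pred b
    r = y + w
    z = b ^ r ∸ w
    -- Here `s z + i * e` equals `2k + 1`, and only `k` modulo `e` matters. The remainder keeps both
    -- `j` and `suc j` below `b`.
    j = k % e
    p = k / e
    n = suc j * b ^ r ∸ r
    w≤b^r : w ≤ b ^ r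
    w≤b^r = ≤-trans (m≤n+m w y) (<⇒≤ (n<b^n b r))
    1+j<b : suc j < b
    1+j<b = subst (suc j <_) (suc-pred b) (s≤s (m%n<n k e))
    upper : y + w + n ≡ suc j * b ^ r
    upper = m+[n∸m]≡n (≤-trans (<⇒≤ (n<b^n b r)) (m≤m+n (b ^ r) _))
    lower : y + n ≡ z + j * b ^ r
    lower = +-cancelʳ-≡ w _ _ (begin
      y + n + w              ≡⟨ swapʳ y n w ⟩
      y + w + n              ≡⟨ upper ⟩
      b ^ r + j * b ^ r      ≡⟨ cong (_+ j * b ^ r) (m∸n+n≡m w≤b^r) ⟨
      z + w + j * b ^ r      ≡⟨ swapʳ z w (j * b ^ r) ⟩
      z + j * b ^ r + w      ∎)
      where
      open ≡-Reasoning
      swapʳ : ∀ x y z → x + y + z ≡ x + z + y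
      swapʳ = solve-∀
    f-upper : f (y + w + n) ≡ c + suc j ^ 2
    f-upper = cong (c +_) (trans (cong s upper) (trans (s-*^ r (suc j)) (s-digit 1+j<b)))
    f-lower : f (y + n) ≡ c + (s z + j ^ 2)
    f-lower = cong (c +_) (trans (cong s lower)
      -- `0 < w` gives `z < b ^ r`, so the digits of `z` stay below the digit `j`.
      (trans (s-+-*^ r (∸-monoʳ-< 0<w w≤b^r) j) (cong (s z +_) (s-digit (<⇒≤ 1+j<b)))))
    congruent : f (y + w + n) + 2 * p * e ≡ f (y + n) + i * e
    congruent = begin
      f (y + w + n) + 2 * p * e            ≡⟨ cong (_+ 2 * p * e) f-upper ⟩
      c + suc j ^ 2 + 2 * p * e            ≡⟨ regroup₁ c j p e ⟩
      c + j ^ 2 + (1 + 2 * (j + p * e))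
        ≡⟨ cong (λ v → c + j ^ 2 + (1 + 2 * v)) (m≡m%n+[m/n]*n k e) ⟨
      c + j ^ 2 + (1 + 2 * k)              ≡⟨ cong (λ v → c + j ^ 2 + suc v) (*-comm 2 k) ⟩
      c + j ^ 2 + suc (k * 2)              ≡⟨ cong (c + j ^ 2 +_) (suc-injective eq) ⟨
      c + j ^ 2 + (s z + i * e)            ≡⟨ regroup₂ c (j ^ 2) (s z) (i * e) ⟩
      c + (s z + j ^ 2) + i * e            ≡⟨ cong (_+ i * e) f-lower ⟨
      f (y + n) + i * e                    ∎
      where
      open ≡-Reasoning
      regroup₁ : ∀ c j p e → c + suc j * (suc j * 1) + 2 * p * e ≡
                 c + j * (j * 1) + (1 + 2 * (j + p * e))
      regroup₁ = solve-∀
      regroup₂ : ∀ c a q v → c + a + (q + v) ≡ c + (q + a) + v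
      regroup₂ = solve-∀
    merged : Mergeable (f (y + w + n)) (f (y + n))
    merged = congruent⇒mergeable (2 * p) i congruent

  ≤⇒mergeable : ∀ {x y} → y ≤ x → x ∼ y → Mergeable x y
  ≤⇒mergeable {x} {y} y≤x x∼y with m≤n⇒m<n∨m≡n y≤x
  ... | inj₂ refl = [] , refl
  ... | inj₁ y<x  = subst (λ v → Mergeable v y) y+w≡x
    (mergeable-+ y (x ∸ y) (m<n⇒0<n∸m y<x) (subst (_∼ y) (sym y+w≡x) x∼y))
    where
    y+w≡x : y + (x ∸ y) ≡ x
    y+w≡x = m+[n∸m]≡n y≤x

  ∼⇒mergeable : ∀ {x y} → x ∼ y → Mergeable x y
  ∼⇒mergeable {x} {y} x∼y with ≤-total x y
  ... | inj₁ x≤y = Mergeable-sym (≤⇒mergeable x≤y (∼-sym {x} x∼y))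
  ... | inj₂ y≤x = ≤⇒mergeable y≤x x∼y

  -- Sending a finite set to `u`

  -- f (u·bʳ) = f u, so arbitrarily large numbers enter the cycle of u.
  run-to : ∀ {u} → U c b u → ∀ a → ∃[ ns ] run ns a ≡ u
  -- The cycle equation has `suc m` steps: the first is the application of `f` after adding `n`, and
  -- the zeros supply the other `m`.
  run-to {u} (0<u , suc m , _ , cycle) a = n ∷ replicate m 0 , (begin
    run (replicate m 0) (f (a + n))  ≡⟨ run-zeros m _ ⟩
    iterate f (f (a + n)) m          ≡⟨ cong (λ x → iterate f (f x) m) (m+[n∸m]≡n a≤u*b^a) ⟩
    iterate f (f (u * b ^ a)) m      ≡⟨ cong (λ x → iterate f (c + x) m) (s-*^ a u) ⟩
    iterate f (f u) m                ≡⟨ cycle ⟩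
    u                                ∎)
    where
    open ≡-Reasoning
    n = u * b ^ a ∸ a
    a≤u*b^a : a ≤ u * b ^ a
    a≤u*b^a = ≤-trans (<⇒≤ (n<b^n b a)) (m≤n*m (b ^ a) u {{>-nonZero 0<u}})

  -- A word `ms` merging the last two terms leaves the images of `t 0` to `t N` to treat; `run-∼`
  -- keeps them related.
  run-all-to : ∀ {u} → U c b u → ∀ N (t : ℕ → ℕ) → (∀ i j → t i ∼ t j) →
               ∃[ ns ] (∀ {i} → i ≤ N → run ns (t i) ≡ u)
  run-all-to u∈U zero    t t∼t with run-to u∈U (t 0)
  ... | ns , eq = ns , λ { z≤n → eq }
  run-all-to {u} u∈U (suc N) t t∼t = ms ++ ns , λ {i} i≤1+N → trans (run-++ ms ns (t i)) (reach i≤1+N)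
    where
    merged : Mergeable (t (suc N)) (t N)
    merged = ∼⇒mergeable (t∼t (suc N) N)
    ms = proj₁ merged
    rest = run-all-to u∈U N (run ms ∘ t) (λ i j → run-∼ ms {t i} (t∼t i j))
    ns = proj₁ rest
    reach : ∀ {i} → i ≤ suc N → run ns (run ms (t i)) ≡ u
    reach i≤1+N with m≤n⇒m<n∨m≡n i≤1+N
    ... | inj₁ i<1+N = proj₂ rest (s≤s⁻¹ i<1+N)
    ... | inj₂ refl  = trans (cong (run ns) (proj₂ merged)) (proj₂ rest ≤-refl)

-- The arithmetic sequence

tabulate-consecutive : ∀ {d} (t : ℕ → ℕ) → (∀ i → t (suc i) ≡ t i + d) →
                       ∀ n → Consecutive d (tabulate {n = n} (t ∘ toℕ))
tabulate-consecutive t step zero          = []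
tabulate-consecutive t step (suc zero)    = [-]
tabulate-consecutive t step (suc (suc n)) =
  step 0 ∷ tabulate-consecutive (t ∘ suc) (step ∘ suc) (suc n)

theorem3p2 : (c b : ℕ) → .{{_ : NonTrivial b}} → (u : ℕ) → U c b u →
    (N : ℕ) → 0 < N →
    Σ[ as ∈ Vec ℕ N ] (Consecutive (gcd 2 (b ∸ 1)) as × All (Attracted c b u) as)
theorem3p2 c b u u∈U N _ =
  tabulate ((λ i → t i + n) ∘ toℕ) ,
  tabulate-consecutive (λ i → t i + n) (λ i → step i d n) N ,
  tabulate⁺ λ i → z<s , length ns ,
    trans (proj₂ shift (<⇒≤ (toℕ<n i))) (proj₂ attracted (<⇒≤ (toℕ<n i)))
  where
  open Attraction c b
  d = gcd 2 (b ∸ 1)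
  t : ℕ → ℕ
  -- Starting at 1 keeps all terms positive after any translation.
  t i = 1 + i * d
  t∼t : ∀ i j → t i ∼ t j
  -- If `pred b` is even then so is `d`, and all terms are odd.
  t∼t i j 2∣b-1 = subst (2 ∣_) (regroup i j d)
    (∣m∣n⇒∣m+n ∣-refl (∣n⇒∣m*n (i + j) (gcd-greatest ∣-refl 2∣b-1)))
    where
    regroup : ∀ i j d → 2 + (i + j) * d ≡ 1 + i * d + (1 + j * d)
    regroup = solve-∀
  attracted = run-all-to u∈U N t t∼t
  ns = proj₁ attracted
  -- The whole word is traded for one translation by `n`, which preserves the common difference.
  shift = run⇒iterate ns t N
  n = proj₁ shift
  step : ∀ i d n → 1 + suc i * d + n ≡ 1 + i * d + n + d
  step = solve-∀
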